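{- Let $T$ be a finite tree of order $n(T)\ge 3$ that is $q$-critical, where $q\ge 1$ is an integer. Then $q=n(T)-1$ if and only if $T$ is isomorphic to $K_{1,r}\odot K_1$ for some integer $r\ge 1$.
   Context: All graphs are finite and simple; $n(G)$ is the number of vertices of $G$. A set $D\subseteq V(G)$ is dominating if every vertex of $V(G)\setminus D$ has a neighbour in $D$; $\gamma(G)$ is the minimum cardinality of a dominating set of $G$. For $F\subseteq E(G)$, $G_F$ denotes the graph obtained from $G$ by subdividing each edge of $F$ exactly once (each edge $uv\in F$ is replaced by a path $u,w,v$ with a new vertex $w$). For an integer $q\ge 1$, a connected graph $G$ of order at least $3$ is called $q$-critical ($\gamma$-$q$-critical) if $\gamma(G_F)>\gamma(G)$ for every $F\subseteq E(G)$ with $|F|=q$, and there is a set $F'\subseteq E(G)$ with $|F'|=q-1$ such that $\gamma(G_{F'})=\gamma(G)$. The corona $G\odot K_1$ is the graph obtained from $G$ by attaching to each vertex $v$ of $G$ exactly one new vertex of degree one adjacent to $v$. $K_{1,r}$ is the star with $r$ leaves. (The graphs $K_{1,r}\odot K_1$ are the slightly wounded spiders, i.e. the graphs obtained from a star $K_{1,t}$, $t=r+1\ge 2$, by subdividing exactly $t-1$ of its edges.) -}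

module Defs where

open import Data.Empty using (⊥)
open import Data.Fin using (Fin; zero; suc; splitAt) renaming (_<_ to _<ᶠ_)
open import Data.Fin.Properties using (_≟_; all?; any?)
open import Data.Fin.Subset using (Subset; inside; outside; _∈_; _∉_; ∣_∣)
  renaming (⊤ to full)
open import Data.Fin.Subset.Properties using (_∈?_; ∈⊤; ∣⊤∣≡n)
open import Data.List
  using (List; []; _∷_; _++_; _∷ʳ_; map; filter; length; lookup)
open import Data.List.Extrema.Nat using (min; min≤xs; argmin-sel)
open import Data.List.Membership.Propositional using ()
  renaming (_∈_ to _∈ˡ_; _∉_ to _∉ˡ_)
import Data.List.Membership.DecPropositional as DecMembership
open import Data.List.Membership.Propositional.Properties
  using (∈-map⁺; ∈-map⁻; ∈-++⁺ˡ; ∈-++⁺ʳ; ∈-filter⁺; ∈-filter⁻)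
open import Data.List.Relation.Unary.All as All using (All)
open import Data.List.Relation.Unary.Any using (here)
open import Data.List.Relation.Unary.Linked using (Linked)
open import Data.List.Relation.Unary.Unique.Propositional using (Unique)
open import Data.Nat using (ℕ; suc; _+_; _∸_; _≤_; _<_)
open import Data.Product using (∃-syntax; _×_; _,_; swap; proj₁; proj₂)
open import Data.Product.Properties using (≡-dec)
open import Data.Sum using (_⊎_; inj₁; inj₂)
open import Data.Unit using (⊤; tt)
open import Data.Vec using ([]; _∷_)
open import Function using (id; _on_; _↔_; _⇔_; Inverse)
open import Level using (0ℓ)
open import Relation.Binary using (Rel; Symmetric; Decidable)
open import Relation.Binary.Construct.Closure.ReflexiveTransitive using (Star)
open import Relation.Binary.PropositionalEquality using (_≡_; refl; sym; trans)
open import Relation.Nullary using (¬_; Dec; yes; no; contradiction)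
open import Relation.Nullary.Decidable using (¬?; _×-dec_; _⊎-dec_; _→-dec_)

record SimpleGraph (V : Set) : Set₁ where
  infix 4 _~_ _~?_
  field
    _~_      : Rel V 0ℓ
    _~?_     : Decidable _~_
    ~-sym    : Symmetric _~_
    ~-irrefl : ∀ {v} → ¬ (v ~ v)

Graph : ℕ → Set₁
Graph n = SimpleGraph (Fin n)

comap : {V W : Set} → (W → V) → SimpleGraph V → SimpleGraph W
comap f G = record
  { _~_      = _~_ on f
  ; _~?_     = λ u v → f u ~? f v
  ; ~-sym    = ~-sym
  ; ~-irrefl = ~-irrefl
  } where open SimpleGraph G

record _≅_ {V W : Set} (G : SimpleGraph V) (H : SimpleGraph W) : Set where
  private
    module G = SimpleGraph G
    module H = SimpleGraph H
  field
    bijection : V ↔ W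
  open Inverse bijection public using (to; from)
  field
    preserves : ∀ u v → (u G.~ v) ⇔ (to u H.~ to v)

module _ {V : Set} (G : SimpleGraph V) where
  open SimpleGraph G

  Connected : Set
  Connected = ∀ u v → Star _~_ u v

  -- The cycle v, v₁, …, vₖ, v is presented by v and vs = v₁, …, vₖ (k ≥ 2).
  IsCycle : V → List V → Set
  IsCycle v vs = 2 ≤ length vs × Unique (v ∷ vs) × Linked _~_ (v ∷ vs ∷ʳ v)

  Acyclic : Set
  Acyclic = ∀ v vs → ¬ IsCycle v vs

  IsTree : Set
  IsTree = Connected × Acyclic

subsets : ∀ n → List (Subset n)
subsets 0       = [] ∷ []
subsets (suc n) = map (outside ∷_) (subsets n) ++ map (inside ∷_) (subsets n)

∈-subsets : ∀ {n} (D : Subset n) → D ∈ˡ subsets n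
∈-subsets []            = here refl
∈-subsets (outside ∷ D) = ∈-++⁺ˡ (∈-map⁺ (outside ∷_) (∈-subsets D))
∈-subsets (inside  ∷ D) = ∈-++⁺ʳ _ (∈-map⁺ (inside ∷_) (∈-subsets D))

module _ {n : ℕ} (G : Graph n) where
  open SimpleGraph G

  Dominating : Subset n → Set
  Dominating D = ∀ v → v ∉ D → ∃[ u ] u ∈ D × v ~ u

  dominating? : ∀ D → Dec (Dominating D)
  dominating? D = all? λ v →
    ¬? (v ∈? D) →-dec any? λ u → (u ∈? D) ×-dec (v ~? u)

  -- The seed n does not affect the minimum, because the set of all n
  -- vertices is dominating.
  γ : ℕ
  γ = min n (map ∣_∣ (filter dominating? (subsets n)))

  γ-attained : ∃[ D ] Dominating D × ∣ D ∣ ≡ γ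
  γ-attained with argmin-sel id n (map ∣_∣ (filter dominating? (subsets n)))
  ... | inj₁ γ≡n = full , (λ v v∉ → contradiction ∈⊤ v∉) , trans (∣⊤∣≡n n) (sym γ≡n)
  ... | inj₂ γ∈  with ∈-map⁻ ∣_∣ γ∈
  ... | D , D∈ , γ≡∣D∣ = D , proj₂ (∈-filter⁻ dominating? {xs = subsets n} D∈) , sym γ≡∣D∣

  γ-minimal : ∀ D → Dominating D → γ ≤ ∣ D ∣
  γ-minimal D dom = All.lookup (min≤xs n _)
    (∈-map⁺ ∣_∣ (∈-filter⁺ dominating? (∈-subsets D) dom))

-- The edge {u , v} is represented by the pair (u , v) with u < v, and a set
-- of edges by a list without repetitions, whose length is its cardinality.
Edges : ℕ → Set
Edges n = List (Fin n × Fin n)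

infix 4 _⊆E_

_⊆E_ : ∀ {n} → Edges n → Graph n → Set
F ⊆E G = Unique F × All (λ (u , v) → u <ᶠ v × u ~ v) F
  where open SimpleGraph G

module _ {n : ℕ} (G : Graph n) (F : Edges n) where
  open SimpleGraph G
  open DecMembership (≡-dec (_≟_ {n}) (_≟_ {n})) using () renaming (_∈?_ to _∈ˡ?_)

  private
    Endpoint : Fin n → Fin (length F) → Set
    Endpoint u i = u ≡ proj₁ (lookup F i) ⊎ u ≡ proj₂ (lookup F i)

    endpoint? : Decidable Endpoint
    endpoint? u i = (u ≟ proj₁ (lookup F i)) ⊎-dec (u ≟ proj₂ (lookup F i))

    -- inj₂ i is the new vertex on the i-th edge of F.
    Adj : Rel (Fin n ⊎ Fin (length F)) 0ℓ
    Adj (inj₁ u) (inj₁ v) = u ~ v × (u , v) ∉ˡ F × (v , u) ∉ˡ F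
    Adj (inj₁ u) (inj₂ i) = Endpoint u i
    Adj (inj₂ i) (inj₁ v) = Endpoint v i
    Adj (inj₂ _) (inj₂ _) = ⊥

    adj? : Decidable Adj
    adj? (inj₁ u) (inj₁ v) =
      (u ~? v) ×-dec ¬? ((u , v) ∈ˡ? F) ×-dec ¬? ((v , u) ∈ˡ? F)
    adj? (inj₁ u) (inj₂ i) = endpoint? u i
    adj? (inj₂ i) (inj₁ v) = endpoint? v i
    adj? (inj₂ _) (inj₂ _) = no λ ()

    adj-sym : Symmetric Adj
    adj-sym {inj₁ _} {inj₁ _} (a , p) = ~-sym a , swap p
    adj-sym {inj₁ _} {inj₂ _} e = e
    adj-sym {inj₂ _} {inj₁ _} e = e

    adj-irrefl : ∀ {v} → ¬ Adj v v
    adj-irrefl {inj₁ _} (a , _) = ~-irrefl a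

  subdivide⊎ : SimpleGraph (Fin n ⊎ Fin (length F))
  subdivide⊎ = record
    { _~_ = Adj ; _~?_ = adj?
    ; ~-sym = λ {u} {v} → adj-sym {u} {v} ; ~-irrefl = λ {v} → adj-irrefl {v} }

  subdivide : Graph (n + length F)
  subdivide = comap (splitAt n) subdivide⊎

Critical : ∀ {n} → ℕ → Graph n → Set
Critical {n} q G =
    Connected G
  × 3 ≤ n
  × (∀ F → F ⊆E G → length F ≡ q → γ G < γ (subdivide G F))
  × (∃[ F′ ] F′ ⊆E G × length F′ ≡ q ∸ 1 × γ (subdivide G F′) ≡ γ G)

module _ {n : ℕ} (G : Graph n) where
  open SimpleGraph G

  private
    -- inj₂ v is the leaf attached to v.
    Adj : Rel (Fin n ⊎ Fin n) 0ℓ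
    Adj (inj₁ u) (inj₁ v) = u ~ v
    Adj (inj₁ u) (inj₂ v) = u ≡ v
    Adj (inj₂ u) (inj₁ v) = u ≡ v
    Adj (inj₂ _) (inj₂ _) = ⊥

    adj? : Decidable Adj
    adj? (inj₁ u) (inj₁ v) = u ~? v
    adj? (inj₁ u) (inj₂ v) = u ≟ v
    adj? (inj₂ u) (inj₁ v) = u ≟ v
    adj? (inj₂ _) (inj₂ _) = no λ ()

    adj-sym : Symmetric Adj
    adj-sym {inj₁ _} {inj₁ _} = ~-sym
    adj-sym {inj₁ _} {inj₂ _} = sym
    adj-sym {inj₂ _} {inj₁ _} = sym

    adj-irrefl : ∀ {v} → ¬ Adj v v
    adj-irrefl {inj₁ _} = ~-irrefl

  corona⊎ : SimpleGraph (Fin n ⊎ Fin n)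
  corona⊎ = record
    { _~_ = Adj ; _~?_ = adj?
    ; ~-sym = λ {u} {v} → adj-sym {u} {v} ; ~-irrefl = λ {v} → adj-irrefl {v} }

  corona : Graph (n + n)
  corona = comap (splitAt n) corona⊎

module _ (r : ℕ) where
  private
    Adj : Rel (Fin (suc r)) 0ℓ
    Adj zero    (suc _) = ⊤
    Adj (suc _) zero    = ⊤
    Adj _       _       = ⊥

    adj? : Decidable Adj
    adj? zero    zero    = no λ ()
    adj? zero    (suc _) = yes tt
    adj? (suc _) zero    = yes tt
    adj? (suc _) (suc _) = no λ ()

    adj-sym : Symmetric Adj
    adj-sym {zero}  {suc _} _ = tt
    adj-sym {suc _} {zero}  _ = tt

    adj-irrefl : ∀ {v} → ¬ Adj v v
    adj-irrefl {zero}  ()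
    adj-irrefl {suc _} ()

  star : Graph (suc r)
  star = record
    { _~_ = Adj ; _~?_ = adj?
    ; ~-sym = λ {u} {v} → adj-sym {u} {v} ; ~-irrefl = λ {v} → adj-irrefl {v} }

{-# OPTIONS --safe #-}
module Submission where

-- A graph without isolated vertices satisfies 2 γ(T) ≤ n. If at most one edge xy of T
-- is left unsubdivided, every vertex of T_F dominates at most two original vertices, so
-- a dominating set D of T_F has 2 |D| ≥ n. Hence γ(T_F) = γ(T) forces D to split V into
-- pairs. An original vertex in D must be paired along xy, so every edge of T joins a pair
-- or meets a fixed end of xy; a tree of this shape is a slightly wounded spider. The same
-- count rules out F = E(T), so q ≤ n - 1 for every q-critical tree. Conversely, in the
-- spider any set of edges avoiding the pendant edge at the centre can be subdivided
-- without changing γ, so q ≥ n - 1.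

open import Defs
open import Data.Bool using (Bool; true; false; if_then_else_)
open import Data.Empty using (⊥; ⊥-elim)
open import Data.Fin as Fin
  using (Fin; zero; suc; splitAt; join; punchOut; inject≤) renaming (_<_ to _<ᶠ_)
import Data.Fin.Properties as Fin
open import Data.Fin.Permutation using (↔⇒≡)
open import Data.Fin.Permutation.Components using (transpose; transpose-inverse)
open import Data.Fin.Properties
  using (_≟_; any?; injective⇒≤; punchOut-injective; splitAt-join; join-splitAt; inject≤-injective)
open import Data.Fin.Subset
  using (Subset; inside; outside; _∈_; ∣_∣; _∪_; _-_; ⁅_⁆; ∁) renaming (⊥ to ∅)
open import Data.Fin.Subset.Properties
  using ( _∈?_; ∣p∣≤n; ∣⊥∣≡0; ∣⁅x⁆∣≡1; x∈⁅x⁆; x∈p∪q⁺; ∣∁p∣≡n∸∣p∣; x∉∁p⇒x∈p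
        ; x∈p∧x≢y⇒x∈p-y; x∈p⇒∣p-x∣<∣p∣)
open import Data.List using (List; []; _∷_; _∷ʳ_; length; lookup; tabulate)
import Data.List.Membership.DecPropositional as DecMembership
open import Data.List.Membership.Propositional using () renaming (_∈_ to _∈ˡ_; _∉_ to _∉ˡ_)
open import Data.List.Membership.Propositional.Properties using (∈-lookup; ∈-tabulate⁻)
open import Data.List.Properties using (length-tabulate)
open import Data.List.Relation.Unary.All as All using (All; []; _∷_)
import Data.List.Relation.Unary.All.Properties as All
open import Data.List.Relation.Unary.AllPairs using ([]; _∷_)
open import Data.List.Relation.Unary.Any as Any using ()
import Data.List.Relation.Unary.Any.Properties as Any
open import Data.List.Relation.Unary.Linked using (Linked; [-]; _∷_)
open import Data.List.Relation.Unary.Unique.Propositional using (Unique)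
open import Data.List.Relation.Unary.Unique.Propositional.Properties using (tabulate⁺)
open import Data.Nat as ℕ using (ℕ; zero; suc; _+_; _∸_; _≤_; _<_; z≤n; s≤s)
import Data.Nat.Properties as ℕ
open import Data.Product using (∃₂; ∃-syntax; _×_; _,_; proj₁; proj₂)
open import Data.Product.Properties using (≡-dec)
open import Data.Sum using (_⊎_; inj₁; inj₂; [_,_]′; reduce; swap)
open import Data.Sum.Properties using (inj₁-injective; inj₂-injective)
open import Data.Unit using (tt)
open import Data.Vec using (_∷_; []; here; there)
open import Function using (_∘_; id; _⇔_; mk⇔; mk↔ₛ′; Equivalence; Inverse)
open import Level using (0ℓ)
open import Relation.Binary using (Rel; tri<; tri≈; tri>)
open import Relation.Binary.Construct.Closure.ReflexiveTransitive using (Star; ε; _◅_)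
open import Relation.Binary.PropositionalEquality
  using (_≡_; _≢_; refl; sym; trans; cong; cong₂; subst; subst₂)
open import Relation.Nullary using (¬_; Dec; yes; no; does; contradiction)
open import Relation.Nullary.Decidable using (_×-dec_; _⊎-dec_; ¬?; dec-true)

private variable
  n k : ℕ

-- Counting on finite sets

-- A missed value `t` could be punched out of the codomain, leaving an injection into a set with
-- fewer than `n` elements.
injective⇒onto : {f : Fin n → Fin k} → (∀ {u v} → f u ≡ f v → u ≡ v) →
  k ≤ n → ∀ t → ∃[ v ] f v ≡ t
injective⇒onto {k = suc k} {f} inj k<n t with any? (λ v → f v ≟ t)
... | yes hit = hit
... | no miss = contradiction
  (ℕ.≤-trans k<n (injective⇒≤ {f = λ v → punchOut (t≢f v)} λ {u} {v} eq →
    inj (punchOut-injective (t≢f u) (t≢f v) eq)))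
  ℕ.1+n≰n
  where
  t≢f : ∀ v → t ≢ f v
  t≢f v eq = miss (v , sym eq)

-- Every fibre has at most two elements, phrased without counting: among three points with one
-- value, two coincide.
AtMostTwoToOne : {A B : Set} → (A → B) → Set
AtMostTwoToOne ι = ∀ {u v w} → ι u ≡ ι v → ι v ≡ ι w → u ≡ v ⊎ v ≡ w ⊎ u ≡ w

module _ (ι : Fin n → Fin k) (b : Fin n → Bool) where

  -- The bit `b` tells the points of a fibre of `ι` apart. If it succeeds, labels are injective, and
  -- `k + k ≤ n` makes them onto. This serves twice: to count dominated vertices, and to give
  -- coordinates in a corona.
  label : Fin n → Fin k ⊎ Fin k
  label v = if b v then inj₁ (ι v) else inj₂ (ι v)

  module _ (separates : ∀ {u v} → ι u ≡ ι v → b u ≡ b v → u ≡ v) where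

    label-injective : ∀ {u v} → label u ≡ label v → u ≡ v
    label-injective {u} {v} eq with b u in bu | b v in bv
    ... | true  | true  = separates (inj₁-injective eq) (trans bu (sym bv))
    ... | false | false = separates (inj₂-injective eq) (trans bu (sym bv))

    join-label-injective : ∀ {u v} → join k k (label u) ≡ join k k (label v) → u ≡ v
    join-label-injective {u} {v} eq = label-injective
      (trans (sym (splitAt-join k k (label u)))
        (trans (cong (splitAt k) eq) (splitAt-join k k (label v))))

    label-onto : k + k ≤ n → ∀ s → ∃[ v ] label v ≡ s
    label-onto 2k≤n s with injective⇒onto join-label-injective 2k≤n (join k k s)
    ... | v , eq = v , trans (sym (splitAt-join k k (label v)))
                        (trans (cong (splitAt k) eq) (splitAt-join k k s))

    label-true : ∀ {v t} → label v ≡ inj₁ t → b v ≡ true × ι v ≡ t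
    label-true {v} eq with true ← b v = refl , inj₁-injective eq

    label-false : ∀ {v t} → label v ≡ inj₂ t → b v ≡ false × ι v ≡ t
    label-false {v} eq with false ← b v = refl , inj₂-injective eq

module _ (ι : Fin n → Fin k) (two : AtMostTwoToOne ι) where
  private
    repeated? : ∀ v → Dec (∃[ u ] (u <ᶠ v × ι u ≡ ι v))
    repeated? v = any? λ u → (u Fin.<? v) ×-dec (ι u ≟ ι v)

    repeated : Fin n → Bool
    repeated v = does (repeated? v)

    -- The larger point `v` of the fibre is repeated because of `u`. Were `u` repeated too, a point
    -- below it would be a third element of the fibre.
    ordered : ∀ {u v} → ι u ≡ ι v → u <ᶠ v → repeated u ≢ repeated v
    ordered {u} {v} eq u<v same with repeated? u
    ... | no _ = contradiction (trans same (dec-true (repeated? v) (u , u<v , eq))) λ ()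
    ... | yes (t , t<u , eq′) with two eq′ eq
    ...   | inj₁ refl        = Fin.<-irrefl refl t<u
    ...   | inj₂ (inj₁ refl) = Fin.<-irrefl refl u<v
    ...   | inj₂ (inj₂ refl) = Fin.<-asym t<u u<v

    separates : ∀ {u v} → ι u ≡ ι v → repeated u ≡ repeated v → u ≡ v
    separates {u} {v} eq same with Fin.<-cmp u v
    ... | tri< u<v _ _ = contradiction same (ordered eq u<v)
    ... | tri≈ _ u≡v _ = u≡v
    ... | tri> _ _ v<u = contradiction (sym same) (ordered (sym eq) v<u)

  abstract
    -- Both labels over `t` are attained, and their preimages differ in the bit `repeated`.
    covered-twice : k + k ≤ n → ∀ t → ∃₂ λ u v → u ≢ v × ι u ≡ t × ι v ≡ t
    covered-twice 2k≤n t
      with u , lu ← label-onto ι repeated separates 2k≤n (inj₁ t)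
         | v , lv ← label-onto ι repeated separates 2k≤n (inj₂ t)
      with ru , ιu ← label-true ι repeated separates lu
         | rv , ιv ← label-false ι repeated separates lv
      = u , v , (λ { refl → contradiction (trans (sym ru) rv) λ () }) , ιu , ιv

-- Numbers the elements of `D`, so that a map into `D` becomes a map into `Fin ∣ D ∣` and the
-- counting lemmas apply to it.
rank : (D : Subset n) (d : Fin n) → d ∈ D → Fin ∣ D ∣
rank (inside  ∷ D) zero    here      = zero
rank (inside  ∷ D) (suc d) (there p) = suc (rank D d p)
rank (outside ∷ D) (suc d) (there p) = rank D d p

rank-injective : ∀ (D : Subset n) {c d} (p : c ∈ D) (q : d ∈ D) → rank D c p ≡ rank D d q → c ≡ d
rank-injective (inside  ∷ D) here      here      eq = refl
rank-injective (inside  ∷ D) (there p) (there q) eq =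
  cong suc (rank-injective D p q (Fin.suc-injective eq))
rank-injective (outside ∷ D) (there p) (there q) eq = cong suc (rank-injective D p q eq)

rank-cong : ∀ (D : Subset n) {c d} (p : c ∈ D) (q : d ∈ D) → c ≡ d → rank D c p ≡ rank D d q
rank-cong (inside  ∷ D) here      here      refl = refl
rank-cong (inside  ∷ D) (there p) (there q) refl = cong suc (rank-cong D p q refl)
rank-cong (outside ∷ D) (there p) (there q) refl = rank-cong D p q refl

∣p∪q∣≤∣p∣+∣q∣ : ∀ (p q : Subset n) → ∣ p ∪ q ∣ ≤ ∣ p ∣ + ∣ q ∣
∣p∪q∣≤∣p∣+∣q∣ []            []            = z≤n
∣p∪q∣≤∣p∣+∣q∣ (outside ∷ p) (outside ∷ q) = ∣p∪q∣≤∣p∣+∣q∣ p q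
∣p∪q∣≤∣p∣+∣q∣ (outside ∷ p) (inside  ∷ q) =
  ℕ.≤-trans (s≤s (∣p∪q∣≤∣p∣+∣q∣ p q)) (ℕ.≤-reflexive (sym (ℕ.+-suc ∣ p ∣ ∣ q ∣)))
∣p∪q∣≤∣p∣+∣q∣ (inside  ∷ p) (outside ∷ q) = s≤s (∣p∪q∣≤∣p∣+∣q∣ p q)
∣p∪q∣≤∣p∣+∣q∣ (inside  ∷ p) (inside  ∷ q) =
  s≤s (ℕ.≤-trans (∣p∪q∣≤∣p∣+∣q∣ p q) (ℕ.+-monoʳ-≤ ∣ p ∣ (ℕ.n≤1+n ∣ q ∣)))

image : (Fin k → Fin n) → Subset n
image {k = zero}  φ = ∅
image {k = suc k} φ = ⁅ φ zero ⁆ ∪ image (φ ∘ suc)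

∈-image : (φ : Fin k → Fin n) → ∀ j → φ j ∈ image φ
∈-image φ zero    = x∈p∪q⁺ (inj₁ (x∈⁅x⁆ (φ zero)))
∈-image φ (suc j) = x∈p∪q⁺ (inj₂ (∈-image (φ ∘ suc) j))

∣image∣≤ : (φ : Fin k → Fin n) → ∣ image φ ∣ ≤ k
∣image∣≤ {zero}  {n} φ = ℕ.≤-reflexive (∣⊥∣≡0 n)
∣image∣≤ {suc k} φ = ℕ.≤-trans (∣p∪q∣≤∣p∣+∣q∣ ⁅ φ zero ⁆ (image (φ ∘ suc)))
  (ℕ.+-mono-≤ (ℕ.≤-reflexive (∣⁅x⁆∣≡1 (φ zero))) (∣image∣≤ (φ ∘ suc)))

lookup-injective : {A : Set} {xs : List A} → Unique xs →
  ∀ {i j} → lookup xs i ≡ lookup xs j → i ≡ j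
lookup-injective (_  ∷ _)  {zero}  {zero}  _  = refl
lookup-injective (x∉ ∷ _)  {zero}  {suc j} eq = contradiction eq (All.lookup x∉ (∈-lookup j))
lookup-injective (x∉ ∷ _)  {suc i} {zero}  eq = contradiction (sym eq) (All.lookup x∉ (∈-lookup i))
lookup-injective (_  ∷ us) {suc i} {suc j} eq = cong suc (lookup-injective us eq)

-- Edges of trees

least : {P : ℕ → Set} → (∀ m → Dec (P m)) → ∀ {m} → P m → ∃[ l ] (P l × ∀ {j} → P j → l ≤ j)
least P? {m} pm with P? 0
... | yes p0 = 0 , p0 , λ _ → z≤n
least P? {zero}  pm | no ¬p0 = contradiction pm ¬p0
least P? {suc m} pm | no ¬p0 with least (λ j → P? (suc j)) pm
... | l , pl , min = suc l , pl , λ { {zero} p0 → contradiction p0 ¬p0 ; {suc j} pj → s≤s (min pj) }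

Linked-∷ʳ : {A : Set} {R : Rel A 0ℓ} → ∀ xs {b c} →
  Linked R (xs ∷ʳ b) → R b c → Linked R ((xs ∷ʳ b) ∷ʳ c)
Linked-∷ʳ []           [-]     r = r ∷ [-]
Linked-∷ʳ (x ∷ [])     (q ∷ l) r = q ∷ Linked-∷ʳ [] l r
Linked-∷ʳ (x ∷ y ∷ xs) (q ∷ l) r = q ∷ Linked-∷ʳ (y ∷ xs) l r

Unique-∷ʳ : {A : Set} {xs : List A} {c : A} → Unique xs → All (_≢ c) xs → Unique (xs ∷ʳ c)
Unique-∷ʳ []       []         = [] ∷ []
Unique-∷ʳ (x∉ ∷ u) (x≢c ∷ xs≢c) = All.∷ʳ⁺ x∉ x≢c ∷ Unique-∷ʳ u xs≢c

1≤length-∷ʳ : {A : Set} (xs : List A) {c : A} → 1 ≤ length (xs ∷ʳ c)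
1≤length-∷ʳ []      = s≤s z≤n
1≤length-∷ʳ (_ ∷ _) = s≤s z≤n

∷ʳ≢[] : {A : Set} (xs : List A) {c : A} → xs ∷ʳ c ≢ []
∷ʳ≢[] []      ()
∷ʳ≢[] (_ ∷ _) ()

-- The orientation in which `_⊆E_` records the edge between two distinct vertices.
sort : Fin n → Fin n → Fin n × Fin n
sort u v with u Fin.<? v
... | yes _ = u , v
... | no  _ = v , u

sort-cases : ∀ (u v : Fin n) → sort u v ≡ (u , v) ⊎ sort u v ≡ (v , u)
sort-cases u v with u Fin.<? v
... | yes _ = inj₁ refl
... | no  _ = inj₂ refl

sort-< : ∀ {u v : Fin n} → u ≢ v → proj₁ (sort u v) <ᶠ proj₂ (sort u v)
sort-< {u = u} {v} u≢v with u Fin.<? v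
... | yes u<v = u<v
... | no  u≮v with Fin.<-cmp u v
...   | tri< u<v _ _ = contradiction u<v u≮v
...   | tri≈ _ u≡v _ = contradiction u≡v u≢v
...   | tri> _ _ v<u = v<u

sort-sorted : ∀ {u v : Fin n} → u <ᶠ v → sort u v ≡ (u , v)
sort-sorted {u = u} {v} u<v with u Fin.<? v
... | yes _ = refl
... | no u≮v = contradiction u<v u≮v

sort-comm : ∀ (u v : Fin n) → sort u v ≡ sort v u
sort-comm u v with u Fin.<? v | v Fin.<? u
... | yes u<v | yes v<u = contradiction v<u (Fin.<-asym u<v)
... | yes _   | no  _   = refl
... | no  _   | yes _   = refl
... | no u≮v  | no v≮u with Fin.<-cmp u v
...   | tri< u<v _ _  = contradiction u<v u≮v
...   | tri≈ _ refl _ = refl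
...   | tri> _ _ v<u  = contradiction v<u v≮u

sort-injective : ∀ {u v a b : Fin n} → sort u v ≡ sort a b → (u ≡ a × v ≡ b) ⊎ (u ≡ b × v ≡ a)
sort-injective {u = u} {v} {a} {b} eq with u Fin.<? v | a Fin.<? b
sort-injective refl | yes _ | yes _ = inj₁ (refl , refl)
sort-injective refl | yes _ | no  _ = inj₂ (refl , refl)
sort-injective refl | no  _ | yes _ = inj₂ (refl , refl)
sort-injective refl | no  _ | no  _ = inj₁ (refl , refl)

module _ {m : ℕ} (T : Graph (suc m)) (tree : IsTree T) where
  open SimpleGraph T

  root : Fin (suc m)
  root = zero

  -- The walk to the root has exactly `k` steps, not at most `k`; the least such `k` is the distance
  -- to the root.
  Within : ℕ → Fin (suc m) → Set
  Within zero    v = v ≡ root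
  Within (suc k) v = ∃[ u ] (v ~ u × Within k u)

  within? : ∀ k v → Dec (Within k v)
  within? zero    v = v ≟ root
  within? (suc k) v = any? λ u → (v ~? u) ×-dec within? k u

  walk⇒within : ∀ {v} → Star _~_ v root → ∃[ k ] Within k v
  walk⇒within ε        = 0 , refl
  walk⇒within (e ◅ es) with walk⇒within es
  ... | k , w = suc k , _ , e , w

  distance : ∀ v → ∃[ l ] (Within l v × ∀ {j} → Within j v → l ≤ j)
  distance v = least (λ k → within? k v) (proj₂ (walk⇒within (proj₁ tree v root)))

  depth : Fin (suc m) → ℕ
  depth v = proj₁ (distance v)

  depth-root : depth root ≡ 0
  depth-root = ℕ.n≤0⇒n≡0 (proj₂ (proj₂ (distance root)) {0} refl)

  -- The second vertex of a shortest walk to the root. The condition `v ≢ root` stands inside the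
  -- existential so that `parent` is total; the root gets itself as a default.
  parent-exists : ∀ v → ∃[ u ] (v ≢ root → v ~ u × depth u < depth v)
  parent-exists v with distance v
  ... | zero  , v≡root , _ = root , λ v≢root → contradiction v≡root v≢root
  ... | suc l , (u , v~u , w) , _ = u , λ _ → v~u , s≤s (proj₂ (proj₂ (distance u)) w)

  parent : Fin (suc m) → Fin (suc m)
  parent v = proj₁ (parent-exists v)

  ~parent : ∀ {v} → v ≢ root → v ~ parent v
  ~parent {v} v≢root = proj₁ (proj₂ (parent-exists v) v≢root)

  parent-shallower : ∀ {v} → v ≢ root → depth (parent v) < depth v
  parent-shallower {v} v≢root = proj₂ (proj₂ (parent-exists v) v≢root)

  deeper-end≢root : ∀ {a b} → a ≢ b → depth b ≤ depth a → a ≢ root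
  deeper-end≢root a≢b db≤da refl = ℕ.n≮0 (ℕ.<-≤-trans (parent-shallower (a≢b ∘ sym))
    (ℕ.≤-trans db≤da (ℕ.≤-reflexive depth-root)))

  -- A path with an interior vertex would be closed to a cycle by the edge from `b` to `a`.
  cycle-free : ∀ {a b} rs → Linked _~_ (a ∷ rs ∷ʳ b) → Unique (a ∷ rs ∷ʳ b) → b ~ a → rs ≡ []
  cycle-free         []       linked unique b~a = refl
  cycle-free {a} {b} (r ∷ rs) linked unique b~a = ⊥-elim (proj₂ tree a (r ∷ rs ∷ʳ b)
    (s≤s (1≤length-∷ʳ rs) , unique , Linked-∷ʳ (a ∷ r ∷ rs) linked b~a))

  ChildOf : Fin (suc m) → Fin (suc m) → Set
  ChildOf v u = v ≢ root × parent v ≡ u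

  childOf? : ∀ v u → Dec (ChildOf v u)
  childOf? v u = ¬? (v ≟ root) ×-dec (parent v ≟ u)

  -- Extending the deeper end of such a path by its parent keeps the invariant
  -- and lowers the ends, until the path closes up to a cycle.
  no-upper-path : ∀ fuel a rs b → depth a + depth b < fuel →
    Linked _~_ (a ∷ rs ∷ʳ b) → Unique (a ∷ rs ∷ʳ b) →
    All (λ c → depth a ≤ depth c × depth b ≤ depth c) rs →
    (rs ≡ [] → ¬ ChildOf a b × ¬ ChildOf b a) → ⊥
  no-upper-path (suc fuel) a rs b (s≤s bound) linked unique@(a∉ ∷ _) upper open-ended
    with ℕ.≤-total (depth b) (depth a)
  ... | inj₁ db≤da = climb
    where
    a≢b    = proj₂ (All.∷ʳ⁻ a∉)
    a≢root = deeper-end≢root a≢b db≤da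
    lower  = parent-shallower a≢root

    climb : ⊥
    climb with parent a ≟ b
    ... | yes refl =
      proj₁ (open-ended (cycle-free rs linked unique (~-sym (~parent a≢root)))) (a≢root , refl)
    ... | no pa≢b = no-upper-path fuel (parent a) (a ∷ rs) b
      (ℕ.<-≤-trans (ℕ.+-monoˡ-< (depth b) lower) bound)
      (~-sym (~parent a≢root) ∷ linked)
      (((λ eq → ℕ.<⇒≢ lower (cong depth eq))
        ∷ All.∷ʳ⁺ (All.map (λ (da≤dc , _) eq → ℕ.<⇒≢ (ℕ.<-≤-trans lower da≤dc) (cong depth eq)) upper)
            pa≢b)
        ∷ unique)
      ((ℕ.<⇒≤ lower , db≤da)
        ∷ All.map (λ (da≤dc , db≤dc) → ℕ.≤-trans (ℕ.<⇒≤ lower) da≤dc , db≤dc) upper)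
      λ ()
  ... | inj₂ da≤db = climb
    where
    a≢b    = proj₂ (All.∷ʳ⁻ a∉)
    b≢root = deeper-end≢root (a≢b ∘ sym) da≤db
    lower  = parent-shallower b≢root

    climb : ⊥
    climb with parent b ≟ a
    ... | yes refl = proj₂ (open-ended (cycle-free rs linked unique (~parent b≢root))) (b≢root , refl)
    ... | no pb≢a = no-upper-path fuel a (rs ∷ʳ b) (parent b)
      (ℕ.<-≤-trans (ℕ.+-monoʳ-< (depth a) lower) bound)
      (Linked-∷ʳ (a ∷ rs) linked (~parent b≢root))
      (Unique-∷ʳ unique (pb≢a ∘ sym
        ∷ All.∷ʳ⁺ (All.map (λ (_ , db≤dc) eq →
                      ℕ.<⇒≢ (ℕ.<-≤-trans lower db≤dc) (cong depth (sym eq))) upper)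
            (λ eq → ℕ.<⇒≢ lower (cong depth (sym eq)))))
      (All.∷ʳ⁺ (All.map (λ (da≤dc , db≤dc) → da≤dc , ℕ.≤-trans (ℕ.<⇒≤ lower) db≤dc) upper)
        (da≤db , ℕ.<⇒≤ lower))
      λ eq → contradiction eq (∷ʳ≢[] rs)

  -- An edge that joins no child to its parent is a path with empty interior to which
  -- `no-upper-path` applies.
  childOf-edge : ∀ {u v} → u ~ v → ChildOf u v ⊎ ChildOf v u
  childOf-edge {u} {v} u~v with childOf? u v | childOf? v u
  ... | yes uv | _      = inj₁ uv
  ... | _      | yes vu = inj₂ vu
  ... | no ¬uv | no ¬vu = ⊥-elim (no-upper-path _ u [] v ℕ.≤-refl
    (u~v ∷ [-]) (((λ { refl → ~-irrefl u~v }) ∷ []) ∷ [] ∷ []) [] λ _ → ¬uv , ¬vu)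

  parent-end : ∀ {u v} → u ~ v → ∃[ c ] (c ≢ root × sort c (parent c) ≡ sort u v)
  parent-end {u} {v} u~v with childOf-edge u~v
  ... | inj₁ (u≢root , refl) = u , u≢root , refl
  ... | inj₂ (v≢root , refl) = v , v≢root , sort-comm v _

  -- An edge is determined by its child end, and that end is never the root.
  length-⊆E : ∀ F → F ⊆E T → length F < suc m
  length-⊆E F (unique , edges) = injective⇒≤ {f = f} f-injective
    where
    edge : ∀ i → proj₁ (lookup F i) <ᶠ proj₂ (lookup F i) × proj₁ (lookup F i) ~ proj₂ (lookup F i)
    edge i = All.lookup edges (∈-lookup i)

    child : ∀ i → ∃[ c ] (c ≢ root × sort c (parent c) ≡ _)
    child i = parent-end (proj₂ (edge i))

    f : Fin (suc (length F)) → Fin (suc m)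
    -- The extra index takes the root, which no edge uses; this makes the bound strict.
    f zero    = root
    f (suc i) = proj₁ (child i)

    sort-child : ∀ i → sort (f (suc i)) (parent (f (suc i))) ≡ lookup F i
    sort-child i = trans (proj₂ (proj₂ (child i))) (sort-sorted (proj₁ (edge i)))

    f-injective : ∀ {i j} → f i ≡ f j → i ≡ j
    f-injective {zero}  {zero}  _  = refl
    f-injective {zero}  {suc j} eq = contradiction (sym eq) (proj₁ (proj₂ (child j)))
    f-injective {suc i} {zero}  eq = contradiction eq (proj₁ (proj₂ (child i)))
    f-injective {suc i} {suc j} eq = cong suc (lookup-injective unique
      (trans (sym (sort-child i)) (trans (cong (λ c → sort c (parent c)) eq) (sort-child j))))

-- Dominating sets of subdivided graphs

module _ {n : ℕ} (G : Graph n) where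
  open SimpleGraph G

  -- Ore: the complement of a minimum dominating set is dominating.
  γ+γ≤n : (∀ v → ∃[ u ] v ~ u) → γ G + γ G ≤ n
  γ+γ≤n neighbour with γ-attained G
  ... | D , dominating , ∣D∣≡γ = ℕ.≤-trans
    (ℕ.+-mono-≤ (ℕ.≤-reflexive (sym ∣D∣≡γ))
      (ℕ.≤-trans (γ-minimal G (∁ D) co-dominating) (ℕ.≤-reflexive (∣∁p∣≡n∸∣p∣ D))))
    (ℕ.≤-reflexive (ℕ.m+[n∸m]≡n (∣p∣≤n D)))
    where
    co-dominating : Dominating G (∁ D)
    co-dominating v v∉∁D with any? (λ u → (u ∈? ∁ D) ×-dec (v ~? u))
    ... | yes found = found
    -- Here `v` and all its neighbours lie in `D`, so `D - v` still dominates, against the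
    -- minimality of `D`.
    ... | no none = contradiction (γ-minimal G (D - v) smaller)
      (ℕ.<⇒≱ (subst (∣ D - v ∣ <_) ∣D∣≡γ (x∈p⇒∣p-x∣<∣p∣ (x∉∁p⇒x∈p v∉∁D))))
      where
      neighbours∈D : ∀ {u} → v ~ u → u ∈ D
      neighbours∈D {u} v~u with u ∈? ∁ D
      ... | yes u∈∁D = contradiction (u , u∈∁D , v~u) none
      ... | no  u∉∁D = x∉∁p⇒x∈p u∉∁D

      smaller : Dominating G (D - v)
      smaller w w∉ with w ≟ v
      ... | yes refl with u , v~u ← neighbour v =
        u , x∈p∧x≢y⇒x∈p-y (neighbours∈D v~u) (λ { refl → ~-irrefl v~u }) , v~u
      ... | no w≢v with dominating w (λ w∈D → w∉ (x∈p∧x≢y⇒x∈p-y w∈D w≢v))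
      ...   | u , u∈D , w~u with u ≟ v
      ...     | no u≢v   = u , x∈p∧x≢y⇒x∈p-y u∈D u≢v , w~u
      ...     | yes refl = contradiction (x∈p∧x≢y⇒x∈p-y (neighbours∈D (~-sym w~u)) w≢v) w∉

sort-edge : (T : Graph n) → let open SimpleGraph T in
  ∀ {u v} → u ~ v → proj₁ (sort u v) <ᶠ proj₂ (sort u v) × proj₁ (sort u v) ~ proj₂ (sort u v)
sort-edge T {u} {v} u~v = sort-< {u = u} {v} (λ { refl → ~-irrefl u~v }) , adjacent
  where
  open SimpleGraph T
  adjacent : proj₁ (sort u v) ~ proj₂ (sort u v)
  adjacent with sort u v | sort-cases u v
  ... | _ | inj₁ refl = u~v
  ... | _ | inj₂ refl = ~-sym u~v

module _ {n : ℕ} (T : Graph n) (F : Edges n) where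
  open SimpleGraph T
  open DecMembership (≡-dec (_≟_ {n}) (_≟_ {n})) using () renaming (_∈?_ to _∈ˡ?_)

  open SimpleGraph (subdivide⊎ T F) using () renaming (_~_ to _≈_)

  edge-index : ∀ {e} → e ∈ˡ F → ∃[ i ] lookup F i ≡ e
  edge-index e∈F = Any.index e∈F , sym (Any.lookup-index e∈F)

  Joins : Fin (length F) → Fin n → Fin n → Set
  Joins i u v = lookup F i ≡ (u , v) ⊎ lookup F i ≡ (v , u)

  joins-endpointˡ : ∀ {i u v} → Joins i u v → inj₁ u ≈ inj₂ i
  joins-endpointˡ = [ inj₁ ∘ sym ∘ cong proj₁ , inj₂ ∘ sym ∘ cong proj₂ ]′

  joins-endpointʳ : ∀ {i u v} → Joins i u v → inj₁ v ≈ inj₂ i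
  joins-endpointʳ = [ inj₂ ∘ sym ∘ cong proj₂ , inj₁ ∘ sym ∘ cong proj₁ ]′

  edge-cases : ∀ {u v} → u ~ v → inj₁ u ≈ inj₁ v ⊎ ∃[ i ] Joins i u v
  edge-cases {u} {v} u~v with (u , v) ∈ˡ? F | (v , u) ∈ˡ? F
  ... | yes uv∈F | _        with i , eq ← edge-index uv∈F = inj₂ (i , inj₁ eq)
  ... | _        | yes vu∈F with i , eq ← edge-index vu∈F = inj₂ (i , inj₂ eq)
  ... | no uv∉F  | no vu∉F  = inj₁ (u~v , uv∉F , vu∉F)

  unsubdivided-sym : ∀ {u v} → inj₁ u ≈ inj₁ v → inj₁ v ≈ inj₁ u
  unsubdivided-sym (u~v , uv∉F , vu∉F) = ~-sym u~v , vu∉F , uv∉F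

  -- The original vertices in the closed neighbourhood of `s`.
  Hits : Fin n ⊎ Fin (length F) → Fin n → Set
  Hits s v = inj₁ v ≡ s ⊎ inj₁ v ≈ s

  module _ (F⊆T : F ⊆E T) where

    edge : ∀ i → proj₁ (lookup F i) <ᶠ proj₂ (lookup F i) × proj₁ (lookup F i) ~ proj₂ (lookup F i)
    edge i = All.lookup (proj₂ F⊆T) (∈-lookup i)

    endpoints-adjacent : ∀ {u v} i → inj₁ u ≈ inj₂ i → inj₁ v ≈ inj₂ i → u ≢ v → u ~ v
    endpoints-adjacent i (inj₁ refl) (inj₁ refl) u≢v = contradiction refl u≢v
    endpoints-adjacent i (inj₁ refl) (inj₂ refl) u≢v = proj₂ (edge i)
    endpoints-adjacent i (inj₂ refl) (inj₁ refl) u≢v = ~-sym (proj₂ (edge i))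
    endpoints-adjacent i (inj₂ refl) (inj₂ refl) u≢v = contradiction refl u≢v

    -- Enlarging `F` by intact edges lets the bound on the number of edges of a tree limit how many
    -- edges are intact.
    ∷-⊆E : ∀ {u v} → inj₁ u ≈ inj₁ v → (sort u v ∷ F) ⊆E T
    ∷-⊆E {u} {v} (u~v , uv∉ , vu∉) =
      (All.¬Any⇒All¬ F sorted∉ ∷ proj₁ F⊆T) , (sort-edge T u~v ∷ proj₂ F⊆T)
      where
      sorted∉ : sort u v ∉ˡ F
      sorted∉ with sort-cases u v
      ... | inj₁ eq = uv∉ ∘ subst (_∈ˡ F) eq
      ... | inj₂ eq = vu∉ ∘ subst (_∈ˡ F) eq

    ∷∷-⊆E : ∀ {u v x y} → inj₁ u ≈ inj₁ v → inj₁ x ≈ inj₁ y → sort u v ≢ sort x y →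
      (sort u v ∷ sort x y ∷ F) ⊆E T
    ∷∷-⊆E uv xy uv≢xy with ∷-⊆E uv | ∷-⊆E xy
    ... | uv∉ ∷ _ , uvE ∷ _ | uniq , edges = ((uv≢xy ∷ uv∉) ∷ uniq) , (uvE ∷ edges)

  module _ (D : Subset (n + length F)) where

    infix 4 _∈D
    _∈D : Fin n ⊎ Fin (length F) → Set
    s ∈D = join n (length F) s ∈ D

    module _ (dominating : Dominating (subdivide T F) D) where

      abstract
        dominated : ∀ s → s ∈D ⊎ ∃[ t ] (t ∈D × s ≈ t)
        dominated s with join n _ s ∈? D
        ... | yes s∈D = inj₁ s∈D
        ... | no  s∉D with u , u∈D , s≈u ← dominating (join n _ s) s∉D
          rewrite splitAt-join n (length F) s =
          inj₂ (splitAt n u , subst (_∈ D) (sym (join-splitAt n (length F) u)) u∈D , s≈u)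

        hit : ∀ v → ∃[ s ] (s ∈D × Hits s v)
        hit v with dominated (inj₁ v)
        ... | inj₁ v∈D             = inj₁ v , v∈D , inj₁ refl
        ... | inj₂ (t , t∈D , v≈t) = t , t∈D , inj₂ v≈t

      dominator : Fin n → Fin n ⊎ Fin (length F)
      dominator v = proj₁ (hit v)

      -- If no two unsubdivided edges meet, every element of D dominates at most two
      -- original vertices; 2 ∣ D ∣ ≤ n then makes these pairs partition V.
      module _ (F⊆T : F ⊆E T)
        (unsubdivided-matching : ∀ {u v w} → inj₁ u ≈ inj₁ v → inj₁ u ≈ inj₁ w → v ≡ w)
        (2∣D∣≤n : ∣ D ∣ + ∣ D ∣ ≤ n) where

        same-partner : ∀ {u v w} → inj₁ u ≈ inj₁ w → inj₁ v ≈ inj₁ w → u ≡ v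
        same-partner u≈w v≈w = unsubdivided-matching (unsubdivided-sym u≈w) (unsubdivided-sym v≈w)

        -- An original vertex hits itself and, by the matching hypothesis, at most one neighbour
        -- along an intact edge; a subdivision vertex hits the two ends of its edge.
        hits-two : ∀ s {u v w} → Hits s u → Hits s v → Hits s w → u ≡ v ⊎ v ≡ w ⊎ u ≡ w
        hits-two (inj₁ _) (inj₁ refl) (inj₁ refl) _           = inj₁ refl
        hits-two (inj₁ _) (inj₁ refl) _           (inj₁ refl) = inj₂ (inj₂ refl)
        hits-two (inj₁ _) _           (inj₁ refl) (inj₁ refl) = inj₂ (inj₁ refl)
        hits-two (inj₁ a) (inj₂ u≈a)  (inj₂ v≈a)  _           = inj₁ (same-partner u≈a v≈a)
        hits-two (inj₁ a) (inj₂ u≈a)  _           (inj₂ w≈a)  = inj₂ (inj₂ (same-partner u≈a w≈a))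
        hits-two (inj₁ a) _           (inj₂ v≈a)  (inj₂ w≈a)  = inj₂ (inj₁ (same-partner v≈a w≈a))
        hits-two (inj₂ i) (inj₂ (inj₁ refl)) (inj₂ (inj₁ refl)) _                  = inj₁ refl
        hits-two (inj₂ i) (inj₂ (inj₂ refl)) (inj₂ (inj₂ refl)) _                  = inj₁ refl
        hits-two (inj₂ i) (inj₂ (inj₁ refl)) _                  (inj₂ (inj₁ refl)) = inj₂ (inj₂ refl)
        hits-two (inj₂ i) (inj₂ (inj₂ refl)) _                  (inj₂ (inj₂ refl)) = inj₂ (inj₂ refl)
        hits-two (inj₂ i) _                  (inj₂ (inj₁ refl)) (inj₂ (inj₁ refl)) = inj₂ (inj₁ refl)
        hits-two (inj₂ i) _                  (inj₂ (inj₂ refl)) (inj₂ (inj₂ refl)) = inj₂ (inj₁ refl)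

        hits-dominator : ∀ v → Hits (dominator v) v
        hits-dominator v = proj₂ (proj₂ (hit v))

        dominator-hits : ∀ {s v} → dominator v ≡ s → Hits s v
        dominator-hits {v = v} refl = hits-dominator v

        dominator-two : AtMostTwoToOne dominator
        dominator-two {u} {v} {w} u≡v v≡w = hits-two (dominator v)
          (dominator-hits u≡v) (hits-dominator v) (dominator-hits (sym v≡w))

        ι : Fin n → Fin ∣ D ∣
        ι v = rank D _ (proj₁ (proj₂ (hit v)))

        ι⇒dominator : ∀ {u v} → ι u ≡ ι v → dominator u ≡ dominator v
        ι⇒dominator {u} {v} eq = trans (sym (splitAt-join n _ (dominator u)))
          (trans (cong (splitAt n) (rank-injective D _ _ eq)) (splitAt-join n _ (dominator v)))

        dominator⇒ι : ∀ {u v} → dominator u ≡ dominator v → ι u ≡ ι v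
        dominator⇒ι eq = rank-cong D _ _ (cong (join n _) eq)

        ι-two : AtMostTwoToOne ι
        ι-two u≡v v≡w = dominator-two (ι⇒dominator u≡v) (ι⇒dominator v≡w)

        dominates-two : ∀ {s} → s ∈D → ∃₂ λ u v → u ≢ v × dominator u ≡ s × dominator v ≡ s
        dominates-two {s} s∈D with covered-twice ι ι-two 2∣D∣≤n (rank D _ s∈D)
        ... | u , v , u≢v , ιu , ιv = u , v , u≢v , back ιu , back ιv
          where
          back : ∀ {w} → ι w ≡ rank D _ s∈D → dominator w ≡ s
          back {w} eq = trans (sym (splitAt-join n _ (dominator w)))
            (trans (cong (splitAt n) (rank-injective D _ s∈D eq)) (splitAt-join n _ s))

        -- Two vertices already have `s` as their chosen dominator, and `s` hits no third one. So
        -- the choice made by `dominator` was forced.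
        dominator-unique : ∀ {s v} → s ∈D → Hits s v → dominator v ≡ s
        dominator-unique {s} {w} s∈D hit-w with dominates-two s∈D
        ... | u , v , u≢v , du , dv with hits-two s (dominator-hits du) (dominator-hits dv) hit-w
        ...   | inj₁ u≡v         = contradiction u≡v u≢v
        ...   | inj₂ (inj₁ refl) = dv
        ...   | inj₂ (inj₂ refl) = du

        -- Of the two vertices dominated by `a`, one differs from `a` and is therefore joined to it
        -- by an intact edge.
        original∈D : ∀ {a} → inj₁ a ∈D → ∃[ b ] (inj₁ b ≈ inj₁ a)
        original∈D {a} a∈D with dominates-two a∈D
        ... | u , v , u≢v , du , dv
          with dominator-hits du | dominator-hits dv
        ...   | inj₂ u≈a  | _        = u , u≈a
        ...   | inj₁ _    | inj₂ v≈a = v , v≈a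
        ...   | inj₁ refl | inj₁ refl = contradiction refl u≢v

        same-dominator-adjacent : ∀ {u v} → dominator u ≡ dominator v → u ≢ v → u ~ v
        same-dominator-adjacent {u} {v} eq u≢v
          with dominator u | hits-dominator u | dominator-hits (sym eq)
        ... | inj₁ _ | inj₁ refl | inj₁ refl = contradiction refl u≢v
        ... | inj₁ _ | inj₁ refl | inj₂ v≈u  = ~-sym (proj₁ v≈u)
        ... | inj₁ _ | inj₂ u≈v  | inj₁ refl = proj₁ u≈v
        ... | inj₁ a | inj₂ u≈a  | inj₂ v≈a  = contradiction (same-partner u≈a v≈a) u≢v
        ... | inj₂ i | inj₂ u≈i  | inj₂ v≈i  = endpoints-adjacent F⊆T i u≈i v≈i u≢v

        -- On a subdivided edge, look at what dominates the subdivision vertex: if it is in `D`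
        -- itself, it is the dominator of both ends; otherwise one of the ends is in `D`.
        edge-alternatives : ∀ {u v} → u ~ v →
          inj₁ u ≈ inj₁ v ⊎ dominator u ≡ dominator v ⊎ inj₁ u ∈D ⊎ inj₁ v ∈D
        edge-alternatives {u} {v} u~v with edge-cases u~v
        ... | inj₁ u≈v = inj₁ u≈v
        ... | inj₂ (i , joins) with dominated (inj₂ i)
        ...   | inj₁ i∈D = inj₂ (inj₁ (trans (dominator-unique {inj₂ i} i∈D (inj₂ (joins-endpointˡ joins)))
                                        (sym (dominator-unique {inj₂ i} i∈D (inj₂ (joins-endpointʳ joins))))))
        ...   | inj₂ (inj₁ w , w∈D , w≈i) = inj₂ (inj₂ (which joins w≈i))
          where
          which : Joins i u v → inj₁ w ≈ inj₂ i → inj₁ u ∈D ⊎ inj₁ v ∈D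
          which (inj₁ eq) (inj₁ refl) = inj₁ (subst (λ e → inj₁ (proj₁ e) ∈D) eq w∈D)
          which (inj₁ eq) (inj₂ refl) = inj₂ (subst (λ e → inj₁ (proj₂ e) ∈D) eq w∈D)
          which (inj₂ eq) (inj₁ refl) = inj₂ (subst (λ e → inj₁ (proj₁ e) ∈D) eq w∈D)
          which (inj₂ eq) (inj₂ refl) = inj₁ (subst (λ e → inj₁ (proj₂ e) ∈D) eq w∈D)

        -- Without intact edges no original vertex is in `D`, so adjacent vertices share their
        -- dominator. By connectedness all vertices do, but three vertices are too many for one
        -- dominator.
        fully-subdivided-impossible : Connected T → 3 ≤ n → ¬ (∀ {u v} → ¬ (inj₁ u ≈ inj₁ v))
        fully-subdivided-impossible connected (s≤s (s≤s (s≤s _))) full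
          = [ (λ ()) , [ (λ ()) , (λ ()) ]′ ]′ (dominator-two (constant (connected zero (suc zero)))
                                    (constant (connected (suc zero) (suc (suc zero)))))
          where
          none∈D : ∀ {a} → ¬ inj₁ a ∈D
          none∈D a∈D = full (proj₂ (original∈D a∈D))

          constant : ∀ {u v} → Star _~_ u v → dominator u ≡ dominator v
          constant ε = refl
          constant (u~w ◅ ws) with edge-alternatives u~w
          ... | inj₁ u≈w               = contradiction u≈w full
          ... | inj₂ (inj₁ same)       = trans same (constant ws)
          ... | inj₂ (inj₂ (inj₁ u∈D)) = contradiction u∈D none∈D
          ... | inj₂ (inj₂ (inj₂ w∈D)) = contradiction w∈D none∈D

        module _ {x y : Fin n} (x≈y : inj₁ x ≈ inj₁ y)
          (only-xy : ∀ {u v} → inj₁ u ≈ inj₁ v → (u ≡ x × v ≡ y) ⊎ (u ≡ y × v ≡ x)) where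

          original∈D⇒x⊎y : ∀ {a} → inj₁ a ∈D → a ≡ x ⊎ a ≡ y
          original∈D⇒x⊎y a∈D with only-xy (proj₂ (original∈D a∈D))
          ... | inj₁ (_ , a≡y) = inj₂ a≡y
          ... | inj₂ (_ , a≡x) = inj₁ a≡x

          -- Both `x` and `y` would be the unique dominator of `x`.
          ¬x,y∈D : inj₁ x ∈D → ¬ inj₁ y ∈D
          ¬x,y∈D x∈D y∈D
            with refl ← trans (sym (dominator-unique {inj₁ x} x∈D (inj₁ refl)))
                              (dominator-unique {inj₁ y} y∈D (inj₂ x≈y))
            = ~-irrefl (proj₁ x≈y)

          -- The only intact edge `xy` meets `z`. A subdivided edge joins a pair with a common
          -- dominator, or has an end in `D`, which must be `z`.
          through-centre : ∀ {z} → z ≡ x ⊎ z ≡ y → (∀ {a} → inj₁ a ∈D → a ≡ z) →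
            ∀ {u v} → u ~ v → ι u ≡ ι v ⊎ u ≡ z ⊎ v ≡ z
          through-centre {z} z∈xy ∈D⇒z u~v with edge-alternatives u~v
          ... | inj₁ u≈v               = inj₂ (at z∈xy (only-xy u≈v))
            where
            at : ∀ {u v} → z ≡ x ⊎ z ≡ y → (u ≡ x × v ≡ y) ⊎ (u ≡ y × v ≡ x) → u ≡ z ⊎ v ≡ z
            at (inj₁ refl) (inj₁ (u≡x , _)) = inj₁ u≡x
            at (inj₁ refl) (inj₂ (_ , v≡x)) = inj₂ v≡x
            at (inj₂ refl) (inj₁ (_ , v≡y)) = inj₂ v≡y
            at (inj₂ refl) (inj₂ (u≡y , _)) = inj₁ u≡y
          ... | inj₂ (inj₁ same)       = inj₁ (dominator⇒ι same)
          ... | inj₂ (inj₂ (inj₁ u∈D)) = inj₂ (inj₁ (∈D⇒z u∈D))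
          ... | inj₂ (inj₂ (inj₂ v∈D)) = inj₂ (inj₂ (∈D⇒z v∈D))

          -- At most one of `x` and `y` is in `D`. It is taken as the centre; if neither is in `D`,
          -- then `y` serves by default.
          centre : ∃[ z ] (∀ {u v} → u ~ v → ι u ≡ ι v ⊎ u ≡ z ⊎ v ≡ z)
          centre with join n _ (inj₁ x) ∈? D
          ... | yes x∈D = x , through-centre (inj₁ refl) λ a∈D →
            [ id , (λ { refl → contradiction a∈D (¬x,y∈D x∈D) }) ]′ (original∈D⇒x⊎y a∈D)
          ... | no  x∉D = y , through-centre (inj₂ refl) λ a∈D →
            [ (λ { refl → contradiction a∈D x∉D }) , id ]′ (original∈D⇒x⊎y a∈D)

-- Recognising spiders

star⁺ : ∀ {r} {i j : Fin (suc r)} → i ≡ zero → j ≢ zero → SimpleGraph._~_ (star r) i j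
star⁺ {i = zero} {zero}  _ j≢0 = contradiction refl j≢0
star⁺ {i = zero} {suc j} _ _   = tt

star⁻ : ∀ {r} {i j : Fin (suc r)} → SimpleGraph._~_ (star r) i j →
  (i ≡ zero × j ≢ zero) ⊎ (j ≡ zero × i ≢ zero)
star⁻ {i = zero}  {suc j} _ = inj₁ (refl , λ ())
star⁻ {i = suc i} {zero}  _ = inj₂ (refl , λ ())

triangle-free : {V : Set} (G : SimpleGraph V) → Acyclic G → let open SimpleGraph G in
  ∀ {u v w} → u ~ v → v ~ w → w ~ u → ⊥
triangle-free G acyclic {u} {v} {w} u~v v~w w~u = acyclic u (v ∷ w ∷ [])
  ( s≤s (s≤s z≤n)
  , (≢ u~v ∷ (λ { refl → ~-irrefl w~u }) ∷ []) ∷ (≢ v~w ∷ []) ∷ [] ∷ []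
  , u~v ∷ v~w ∷ w~u ∷ [-])
  where
  open SimpleGraph G
  ≢ : ∀ {a b} → a ~ b → a ≢ b
  ≢ a~b refl = ~-irrefl a~b

module _ {n r : ℕ} (T : Graph n) (tree : IsTree T) (ι : Fin n → Fin (suc r))
  (two : AtMostTwoToOne ι) (2k≤n : suc r + suc r ≤ n)
  (matched : ∀ {u v} → ι u ≡ ι v → u ≢ v → SimpleGraph._~_ T u v)
  (z : Fin n) (ι-z : ι z ≡ zero)
  (through-z : ∀ {u v} → SimpleGraph._~_ T u v → ι u ≡ ι v ⊎ u ≡ z ⊎ v ≡ z) where
  open SimpleGraph T
  open SimpleGraph (corona⊎ (star r)) using () renaming (_~_ to _≈_)

  -- The vertices meant for the star inside the corona: its centre `z`, and the neighbours of `z`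
  -- outside the class of `z`.
  Core : Fin n → Set
  Core v = v ≡ z ⊎ (v ~ z × ι v ≢ ι z)

  abstract
    core? : ∀ v → Dec (Core v)
    core? v = (v ≟ z) ⊎-dec ((v ~? z) ×-dec ¬? (ι v ≟ ι z))

  -- Two distinct neighbours of `z` in one class are adjacent and would form a triangle with `z`.
  core-separates : ∀ {u v} → Core u → Core v → ι u ≡ ι v → u ≡ v
  core-separates (inj₁ refl) (inj₁ refl) _ = refl
  core-separates (inj₁ refl) (inj₂ (_ , ιv≢ιz)) eq = contradiction (sym eq) ιv≢ιz
  core-separates (inj₂ (_ , ιu≢ιz)) (inj₁ refl) eq = contradiction eq ιu≢ιz
  core-separates {u} {v} (inj₂ (u~z , _)) (inj₂ (v~z , _)) eq with u ≟ v
  ... | yes u≡v = u≡v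
  ... | no  u≢v = ⊥-elim (triangle-free T (proj₂ tree) (matched eq u≢v) v~z (~-sym u~z))

  -- Two distinct matched non-core vertices form a component avoiding z.
  leaf-separates : ∀ {u v} → ¬ Core u → ¬ Core v → ι u ≡ ι v → u ≡ v
  leaf-separates {u} {v} ¬cu ¬cv eq with u ≟ v | ι v ≟ ι z
  ... | yes u≡v | _ = u≡v
  ... | no  u≢v | yes ιv≡ιz with two eq ιv≡ιz
  ...   | inj₁ u≡v        = u≡v
  ...   | inj₂ (inj₁ v≡z) = contradiction (inj₁ v≡z) ¬cv
  ...   | inj₂ (inj₂ u≡z) = contradiction (inj₁ u≡z) ¬cu
  leaf-separates {u} {v} ¬cu ¬cv eq | no u≢v | no ιv≢ιz =
    contradiction (confined refl (proj₁ tree v z)) (ιv≢ιz ∘ sym)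
    where
    ¬~z : ∀ {w} → ι w ≡ ι v → ¬ w ~ z
    ¬~z ιw w~z with two eq (sym ιw)
    ... | inj₁ u≡v         = contradiction u≡v u≢v
    ... | inj₂ (inj₁ refl) = ¬cv (inj₂ (w~z , ιv≢ιz))
    ... | inj₂ (inj₂ refl) = ¬cu (inj₂ (w~z , ιv≢ιz ∘ trans (sym eq)))

    confined : ∀ {w w′} → ι w ≡ ι v → Star _~_ w w′ → ι w′ ≡ ι v
    confined ιw ε = ιw
    confined ιw (w~t ◅ ts) with through-z w~t
    ... | inj₁ same        = confined (trans (sym same) ιw) ts
    ... | inj₂ (inj₁ refl) = contradiction (sym ιw) ιv≢ιz
    ... | inj₂ (inj₂ refl) = contradiction w~t (¬~z ιw)

  separates : ∀ {u v} → ι u ≡ ι v → does (core? u) ≡ does (core? v) → u ≡ v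
  separates {u} {v} eq same with core? u | core? v
  ... | yes cu | yes cv = core-separates cu cv eq
  ... | no ¬cu | no ¬cv = leaf-separates ¬cu ¬cv eq

  -- The class of a vertex is its index in the star; core vertices go to the star itself, all others
  -- to the attached leaves.
  position : Fin n → Fin (suc r) ⊎ Fin (suc r)
  position = label ι (does ∘ core?)

  core-of-class : ∀ {u} → Core u → ι u ≡ zero → u ≡ z
  core-of-class cu ιu = core-separates cu (inj₁ refl) (trans ιu (sym ι-z))

  core-adjacent-to-z : ∀ {v} → Core v → ι v ≢ zero → v ~ z
  core-adjacent-to-z (inj₁ refl)       ιv≢0 = contradiction ι-z ιv≢0
  core-adjacent-to-z (inj₂ (v~z , _)) _    = v~z

  -- If `u` is `z` and `v` lies in another class, then `v` is itself a core vertex.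
  core-leaf : ∀ {u v} → Core u → ¬ Core v → u ~ v → ι u ≡ ι v
  core-leaf {u} {v} cu ¬cv u~v with through-z u~v
  ... | inj₁ same        = same
  ... | inj₂ (inj₂ v≡z)  = contradiction (inj₁ v≡z) ¬cv
  ... | inj₂ (inj₁ refl) with ι v ≟ ι u
  ...   | yes eq = sym eq
  ...   | no neq = contradiction (inj₂ (~-sym u~v , neq)) ¬cv

  position-preserves : ∀ u v → u ~ v ⇔ position u ≈ position v
  position-preserves u v with core? u | core? v
  ... | yes cu | yes cv = mk⇔ ⇒ (⇐ ∘ star⁻)
    where
    classes-differ : u ~ v → ι u ≢ ι v
    classes-differ u~v eq with refl ← core-separates cu cv eq = ~-irrefl u~v

    ⇒ : u ~ v → SimpleGraph._~_ (star r) (ι u) (ι v)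
    ⇒ u~v with through-z u~v
    ... | inj₁ same        = contradiction same (classes-differ u~v)
    ... | inj₂ (inj₁ refl) = star⁺ ι-z λ ιv → classes-differ u~v (trans ι-z (sym ιv))
    ... | inj₂ (inj₂ refl) = SimpleGraph.~-sym (star r) {ι v} {ι u}
      (star⁺ ι-z λ ιu → classes-differ u~v (trans ιu (sym ι-z)))

    ⇐ : (ι u ≡ zero × ι v ≢ zero) ⊎ (ι v ≡ zero × ι u ≢ zero) → u ~ v
    ⇐ (inj₁ (ιu , ιv≢0)) = subst (_~ v) (sym (core-of-class cu ιu)) (~-sym (core-adjacent-to-z cv ιv≢0))
    ⇐ (inj₂ (ιv , ιu≢0)) = subst (u ~_) (sym (core-of-class cv ιv)) (core-adjacent-to-z cu ιu≢0)
  ... | yes cu | no ¬cv = mk⇔ (core-leaf cu ¬cv) λ eq → matched eq λ { refl → ¬cv cu }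
  ... | no ¬cu | yes cv = mk⇔ (sym ∘ core-leaf cv ¬cu ∘ ~-sym) λ eq → matched eq λ { refl → ¬cu cv }
  ... | no ¬cu | no ¬cv = mk⇔ absurd λ ()
    where
    absurd : u ~ v → ⊥
    absurd u~v with through-z u~v
    ... | inj₁ same       = contradiction (subst (u ~_) (sym (leaf-separates ¬cu ¬cv same)) u~v) ~-irrefl
    ... | inj₂ (inj₁ u≡z) = ¬cu (inj₁ u≡z)
    ... | inj₂ (inj₂ v≡z) = ¬cv (inj₁ v≡z)

  matched-tree≅spider : T ≅ corona (star r)
  matched-tree≅spider = record
    { bijection = mk↔ₛ′ to from to-from from-to
    ; preserves = preserves
    }
    where
    to : Fin n → Fin (suc r + suc r)
    to v = join (suc r) (suc r) (position v)

    onto : ∀ t → ∃[ v ] position v ≡ splitAt (suc r) t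
    onto t = label-onto ι (does ∘ core?) separates 2k≤n (splitAt (suc r) t)

    from : Fin (suc r + suc r) → Fin n
    from t = proj₁ (onto t)

    to-from : ∀ t → to (from t) ≡ t
    to-from t = trans (cong (join (suc r) (suc r)) (proj₂ (onto t))) (join-splitAt (suc r) (suc r) t)

    from-to : ∀ v → from (to v) ≡ v
    from-to v = label-injective ι (does ∘ core?) separates
      (trans (proj₂ (onto (to v))) (splitAt-join (suc r) (suc r) (position v)))

    preserves : ∀ u v → u ~ v ⇔ SimpleGraph._~_ (corona (star r)) (to u) (to v)
    preserves u v rewrite splitAt-join (suc r) (suc r) (position u)
                        | splitAt-join (suc r) (suc r) (position v) = position-preserves u v

transpose-injective : ∀ (i j : Fin n) {a b} → transpose i j a ≡ transpose i j b → a ≡ b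
transpose-injective i j eq =
  trans (sym (transpose-inverse j i)) (trans (cong (transpose j i) eq) (transpose-inverse j i))

transpose-matchˡ : ∀ (i j : Fin n) → transpose i j i ≡ j
transpose-matchˡ i j rewrite dec-true (i ≟ i) refl = refl

-- A transposition renumbers the classes so that the class of `z` becomes `zero`, the centre of the
-- star.
matched-tree-is-spider : (T : Graph n) → IsTree T → (ι : Fin n → Fin k) →
  AtMostTwoToOne ι → k + k ≤ n →
  (∀ {u v} → ι u ≡ ι v → u ≢ v → SimpleGraph._~_ T u v) →
  ∀ z → (∀ {u v} → SimpleGraph._~_ T u v → ι u ≡ ι v ⊎ u ≡ z ⊎ v ≡ z) →
  ∃[ r ] T ≅ corona (star r)
matched-tree-is-spider {k = zero}  T tree ι two 2k≤n matched z through-z with () ← ι z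
matched-tree-is-spider {k = suc r} T tree ι two 2k≤n matched z through-z =
  r , matched-tree≅spider T tree (σ ∘ ι)
    (λ eq eq′ → two (σ-injective eq) (σ-injective eq′)) 2k≤n (matched ∘ σ-injective)
    z (transpose-matchˡ (ι z) zero)
    λ u~v → [ inj₁ ∘ cong σ , inj₂ ]′ (through-z u~v)
  where
  σ = transpose (ι z) zero
  σ-injective = λ {a b} → transpose-injective (ι z) zero {a} {b}

-- Subdividing spiders

module _ {n r : ℕ} (T : Graph n) (iso : T ≅ corona (star r)) where
  open SimpleGraph T
  open SimpleGraph (corona⊎ (star r)) using () renaming (_~_ to _≈ᶜ_)
  open _≅_ iso

  spider-order : n ≡ suc r + suc r
  spider-order = ↔⇒≡ bijection

  place : Fin n → Fin (suc r) ⊎ Fin (suc r)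
  place v = splitAt (suc r) (to v)

  vertex : Fin (suc r) ⊎ Fin (suc r) → Fin n
  vertex s = from (join (suc r) (suc r) s)

  abstract
    place-vertex : ∀ s → place (vertex s) ≡ s
    place-vertex s = trans (cong (splitAt (suc r)) (Inverse.inverseˡ bijection refl))
      (splitAt-join (suc r) (suc r) s)

    vertex-place : ∀ v → vertex (place v) ≡ v
    vertex-place v = Inverse.inverseʳ bijection (join-splitAt (suc r) (suc r) (to v))

  vertex-injective : ∀ s t → vertex s ≡ vertex t → s ≡ t
  vertex-injective s t eq = trans (sym (place-vertex s)) (trans (cong place eq) (place-vertex t))

  ~⇒≈ : ∀ {u v} → u ~ v → place u ≈ᶜ place v
  ~⇒≈ {u} {v} = Equivalence.to (preserves u v)

  ≈⇒~ : ∀ s t → s ≈ᶜ t → vertex s ~ vertex t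
  ≈⇒~ s t s≈t = Equivalence.from (preserves (vertex s) (vertex t))
    (subst₂ _≈ᶜ_ (sym (place-vertex s)) (sym (place-vertex t)) s≈t)

  core leaf : Fin (suc r) → Fin n
  core j = vertex (inj₁ j)
  leaf j = vertex (inj₂ j)

  leaf~core : ∀ j → leaf j ~ core j
  leaf~core j = ≈⇒~ (inj₂ j) (inj₁ j) refl

  leaf-neighbour : ∀ {j} s → inj₂ j ≈ᶜ s → reduce s ≡ j
  leaf-neighbour (inj₁ _) eq = sym eq

  -- Dominating the leaf with index `j` takes that leaf or its core vertex. Both carry the index
  -- `j`, so distinct leaves need distinct elements of `D`.
  γ-spider : suc r ≤ γ T
  γ-spider with D , dominating , ∣D∣≡γ ← γ-attained T = subst (suc r ≤_) ∣D∣≡γ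
    (injective⇒≤ {f = λ j → rank D _ (proj₁ (proj₂ (pendant j)))} λ {i} {j} eq →
      trans (sym (proj₂ (proj₂ (pendant i))))
        (trans (cong (reduce ∘ place) (rank-injective D _ _ eq)) (proj₂ (proj₂ (pendant j)))))
    where
    pendant : ∀ j → ∃[ d ] (d ∈ D × reduce (place d) ≡ j)
    pendant j with leaf j ∈? D
    ... | yes leaf∈D = leaf j , leaf∈D , cong reduce (place-vertex (inj₂ j))
    ... | no  leaf∉D with u , u∈D , leaf~u ← dominating (leaf j) leaf∉D =
      u , u∈D , leaf-neighbour (place u) (subst (_≈ᶜ place u) (place-vertex (inj₂ j)) (~⇒≈ leaf~u))

  module _ (F : Edges n) (F⊆T : F ⊆E T)
    (intact : SimpleGraph._~_ (subdivide⊎ T F) (inj₁ (leaf zero)) (inj₁ (core zero))) where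
    open SimpleGraph (subdivide⊎ T F) using () renaming (_~_ to _≈_)

    -- Leg j is dominated by the subdivision vertex of its leaf edge, or by its core
    -- vertex when that edge is intact.
    Leg : Fin r → Fin n ⊎ Fin (length F) → Set
    Leg j s = (inj₁ (leaf (suc j)) ≈ inj₁ (core (suc j)) × s ≡ inj₁ (core (suc j)))
            ⊎ ∃[ i ] (Joins T F i (leaf (suc j)) (core (suc j)) × s ≡ inj₂ i)

    leg : ∀ j → ∃[ s ] Leg j s
    leg j with edge-cases T F (leaf~core (suc j))
    ... | inj₁ unsubdivided = inj₁ (core (suc j)) , inj₁ (unsubdivided , refl)
    ... | inj₂ (i , joins)     = inj₂ i , inj₂ (i , joins , refl)

    -- A dominating set of the subdivided spider: the centre, whose pendant edge is intact, and one
    -- vertex for each leg.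
    φ : Fin (suc r) → Fin n ⊎ Fin (length F)
    φ zero    = inj₁ (core zero)
    φ (suc j) = proj₁ (leg j)

    sort-joins : ∀ {i u v} → Joins T F i u v → sort u v ≡ lookup F i
    sort-joins {i} {u} {v} joins = trans (same joins) (sort-sorted (proj₁ (edge T F F⊆T i)))
      where
      same : Joins T F i u v → sort u v ≡ sort (proj₁ (lookup F i)) (proj₂ (lookup F i))
      same (inj₁ eq) = sym (cong (λ (a , b) → sort a b) eq)
      same (inj₂ eq) = trans (sort-comm u v) (sym (cong (λ (a , b) → sort a b) eq))

    -- An edge in `F` is not intact, and `F` has no repetitions, so `leg` can only have picked the
    -- subdivision vertex with index `i`.
    leg-of-edge : ∀ i j → Joins T F i (leaf (suc j)) (core (suc j)) → φ (suc j) ≡ inj₂ i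
    leg-of-edge i j joins with leg j
    ... | _ , inj₁ ((_ , ∉ˡ , ∉ʳ) , refl) = contradiction joins
      [ (λ eq → ∉ˡ (subst (_∈ˡ F) eq (∈-lookup i))) , (λ eq → ∉ʳ (subst (_∈ˡ F) eq (∈-lookup i))) ]′
    ... | _ , inj₂ (i′ , joins′ , refl) = cong inj₂
      (lookup-injective (proj₁ F⊆T) (trans (sym (sort-joins joins′)) (sort-joins joins)))

    Covered : Fin n ⊎ Fin (length F) → Set
    Covered s = ∃[ j ] (s ≡ φ j ⊎ s ≈ φ j)

    covered-leg : ∀ j → Covered (inj₁ (core (suc j))) × Covered (inj₁ (leaf (suc j)))
    covered-leg j with leg j in eq
    ... | s , inj₁ (unsubdivided , refl) =
      (suc j , inj₁ (sym (cong proj₁ eq))) ,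
      (suc j , inj₂ (subst (inj₁ _ ≈_) (sym (cong proj₁ eq)) unsubdivided))
    ... | s , inj₂ (i , joins , refl) =
      (suc j , inj₂ (subst (inj₁ _ ≈_) (sym (cong proj₁ eq)) (joins-endpointʳ T F joins))) ,
      (suc j , inj₂ (subst (inj₁ _ ≈_) (sym (cong proj₁ eq)) (joins-endpointˡ T F joins)))

    covered-vertex : ∀ s → Covered (inj₁ (vertex s))
    covered-vertex (inj₁ zero)    = zero , inj₁ refl
    covered-vertex (inj₂ zero)    = zero , inj₂ intact
    covered-vertex (inj₁ (suc j)) = proj₁ (covered-leg j)
    covered-vertex (inj₂ (suc j)) = proj₂ (covered-leg j)

    -- Subdivision vertices on edges at the centre are dominated by the centre. Every other edge is
    -- the leaf edge of a leg, and its subdivision vertex was chosen by `φ`.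
    covered-edge : ∀ i s t → s ≈ᶜ t → Joins T F i (vertex s) (vertex t) → Covered (inj₂ i)
    covered-edge i (inj₁ zero)    _              _    joins = zero , inj₂ (joins-endpointˡ T F joins)
    covered-edge i _              (inj₁ zero)    _    joins = zero , inj₂ (joins-endpointʳ T F joins)
    covered-edge i (inj₁ (suc j)) (inj₂ _)       refl joins =
      suc j , inj₁ (sym (leg-of-edge i j (swap joins)))
    covered-edge i (inj₂ _)       (inj₁ (suc j)) refl joins = suc j , inj₁ (sym (leg-of-edge i j joins))

    covered : ∀ s → Covered s
    covered (inj₁ v) = subst (Covered ∘ inj₁) (vertex-place v) (covered-vertex (place v))
    covered (inj₂ i) = covered-edge i (place _) (place _) (~⇒≈ (proj₂ (edge T F F⊆T i)))
      (inj₁ (sym (cong₂ _,_ (vertex-place _) (vertex-place _))))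

    γ-subdivided-spider : γ (subdivide T F) ≤ suc r
    γ-subdivided-spider = ℕ.≤-trans (γ-minimal (subdivide T F) (image ψ) dominating) (∣image∣≤ ψ)
      where
      ψ : Fin (suc r) → Fin (n + length F)
      ψ j = join n (length F) (φ j)

      dominating : Dominating (subdivide T F) (image ψ)
      dominating w w∉ with covered (splitAt n w)
      ... | j , inj₁ eq  = contradiction
        (subst (_∈ image ψ) (trans (cong (join n _) (sym eq)) (join-splitAt n _ w)) (∈-image ψ j)) w∉
      ... | j , inj₂ w≈φ =
        ψ j , ∈-image ψ j , subst (splitAt n w ≈_) (sym (splitAt-join n _ (φ j))) w≈φ

  -- The `r + r` edges of the spider other than the pendant edge at the centre.
  ray : Fin r ⊎ Fin r → Fin n × Fin n
  ray (inj₁ j) = core (suc j) , core zero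
  ray (inj₂ j) = leaf (suc j) , core (suc j)

  ray-adjacent : ∀ s → proj₁ (ray s) ~ proj₂ (ray s)
  ray-adjacent (inj₁ j) = ≈⇒~ (inj₁ (suc j)) (inj₁ zero) tt
  ray-adjacent (inj₂ j) = leaf~core (suc j)

  ray-avoids : ∀ s → proj₁ (ray s) ≢ leaf zero × proj₂ (ray s) ≢ leaf zero
  ray-avoids (inj₁ j) =
    (λ eq → contradiction (vertex-injective (inj₁ (suc j)) (inj₂ zero) eq) λ ()) ,
    (λ eq → contradiction (vertex-injective (inj₁ zero) (inj₂ zero) eq) λ ())
  ray-avoids (inj₂ j) =
    (λ eq → contradiction (vertex-injective (inj₂ (suc j)) (inj₂ zero) eq) λ ()) ,
    (λ eq → contradiction (vertex-injective (inj₁ (suc j)) (inj₂ zero) eq) λ ())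

  ray-edge : Fin r ⊎ Fin r → Fin n × Fin n
  ray-edge s = sort (proj₁ (ray s)) (proj₂ (ray s))

  ray-edge-injective : ∀ {s t} → ray-edge s ≡ ray-edge t → s ≡ t
  ray-edge-injective {s} {t} eq = go s t (sort-injective eq)
    where
    go : ∀ s t → let (a , b) = ray s; (c , d) = ray t in (a ≡ c × b ≡ d) ⊎ (a ≡ d × b ≡ c) → s ≡ t
    go (inj₁ i) (inj₁ j) (inj₁ (p , _)) with refl ← vertex-injective (inj₁ (suc i)) (inj₁ (suc j)) p = refl
    go (inj₁ i) (inj₁ j) (inj₂ (p , _)) with () ← vertex-injective (inj₁ (suc i)) (inj₁ zero) p
    go (inj₁ i) (inj₂ j) (inj₁ (p , _)) with () ← vertex-injective (inj₁ (suc i)) (inj₂ (suc j)) p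
    go (inj₁ i) (inj₂ j) (inj₂ (_ , p)) with () ← vertex-injective (inj₁ zero) (inj₂ (suc j)) p
    go (inj₂ i) (inj₁ j) (inj₁ (p , _)) with () ← vertex-injective (inj₂ (suc i)) (inj₁ (suc j)) p
    go (inj₂ i) (inj₁ j) (inj₂ (p , _)) with () ← vertex-injective (inj₂ (suc i)) (inj₁ zero) p
    go (inj₂ i) (inj₂ j) (inj₁ (p , _)) with refl ← vertex-injective (inj₂ (suc i)) (inj₂ (suc j)) p = refl
    go (inj₂ i) (inj₂ j) (inj₂ (p , _)) with () ← vertex-injective (inj₂ (suc i)) (inj₁ (suc j)) p

  -- Take the first `q` rays. None of them ends at the leaf attached to the centre, so the pendant
  -- edge there stays intact.
  γ-preserving-edges : ∀ {q} → q ≤ r + r →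
    ∃[ F ] (F ⊆E T × length F ≡ q × γ (subdivide T F) ≤ suc r)
  γ-preserving-edges {q} q≤2r = F , F⊆T , length-tabulate f ,
    γ-subdivided-spider F F⊆T
      ( leaf~core zero
      , avoided {π = proj₁} (proj₁ ∘ avoids) refl
      , avoided {π = proj₂} (proj₂ ∘ avoids) refl)
    where
    source : Fin q → Fin r ⊎ Fin r
    source i = splitAt r (inject≤ i q≤2r)

    f : Fin q → Fin n × Fin n
    f = ray-edge ∘ source

    F = tabulate f

    source-injective : ∀ {i j} → source i ≡ source j → i ≡ j
    source-injective eq = inject≤-injective q≤2r q≤2r _ _
      (trans (sym (join-splitAt r r _)) (trans (cong (join r r) eq) (join-splitAt r r _)))

    F⊆T : F ⊆E T
    F⊆T = tabulate⁺ (source-injective ∘ ray-edge-injective) ,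
      All.tabulate⁺ λ i → sort-edge T (ray-adjacent (source i))

    avoids : ∀ i → proj₁ (f i) ≢ leaf zero × proj₂ (f i) ≢ leaf zero
    avoids i with ray-avoids (source i) | sort-cases (proj₁ (ray (source i))) (proj₂ (ray (source i)))
    ... | a , b | inj₁ eq = a ∘ trans (sym (cong proj₁ eq)) , b ∘ trans (sym (cong proj₂ eq))
    ... | a , b | inj₂ eq = b ∘ trans (sym (cong proj₁ eq)) , a ∘ trans (sym (cong proj₂ eq))

    avoided : {π : Fin n × Fin n → Fin n} → (∀ i → π (f i) ≢ leaf zero) →
      ∀ {e} → π e ≡ leaf zero → e ∉ˡ F
    avoided ne eq e∈F with i , refl ← ∈-tabulate⁻ e∈F = ne i eq

-- Edge sets that preserve the domination number, and critical trees

edge-bound : (T : Graph n) → IsTree T → 1 ≤ n → ∀ F → F ⊆E T → length F < n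
edge-bound T tree (s≤s _) = length-⊆E T tree

connected⇒neighbour : (G : Graph n) → Connected G → 2 ≤ n → ∀ v → ∃[ u ] SimpleGraph._~_ G v u
connected⇒neighbour G connected (s≤s (s≤s _)) v = first-step (other v) (connected v _)
  where
  other : ∀ (v : Fin (suc (suc _))) → ∃[ u ] v ≢ u
  other zero    = suc zero , λ ()
  other (suc v) = zero , λ ()

  first-step : ((w , _) : ∃[ u ] v ≢ u) → Star (SimpleGraph._~_ G) v w →
    ∃[ u ] SimpleGraph._~_ G v u
  first-step (_ , v≢v) ε        = contradiction refl v≢v
  first-step _         (e ◅ es) = _ , e

module _ {n : ℕ} (T : Graph n) (tree : IsTree T) (3≤n : 3 ≤ n)
  (F : Edges n) (F⊆T : F ⊆E T) (γ-preserved : γ (subdivide T F) ≡ γ T) where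
  open SimpleGraph T
  open SimpleGraph (subdivide⊎ T F) using () renaming (_~_ to _≈_; _~?_ to _≈?_)

  private
    D : Subset (n + length F)
    D = proj₁ (γ-attained (subdivide T F))

    dominating : Dominating (subdivide T F) D
    dominating = proj₁ (proj₂ (γ-attained (subdivide T F)))

    -- The size of `D` is the domination number of the subdivided tree, hence that of `T`, to which
    -- Ore's bound applies.
    2∣D∣≤n : ∣ D ∣ + ∣ D ∣ ≤ n
    2∣D∣≤n = subst (λ c → c + c ≤ n)
      (sym (trans (proj₂ (proj₂ (γ-attained (subdivide T F)))) γ-preserved))
      (γ+γ≤n T (connected⇒neighbour T (proj₁ tree) (ℕ.≤-trans (ℕ.n≤1+n 2) 3≤n)))

    length-bound : ∀ E → E ⊆E T → length E < n
    length-bound = edge-bound T tree (ℕ.≤-trans (s≤s z≤n) 3≤n)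

  intact-edge : ∃₂ λ x y → inj₁ x ≈ inj₁ y
  intact-edge with any? (λ x → any? (λ y → inj₁ x ≈? inj₁ y))
  ... | yes found = found
  ... | no  none  = contradiction (λ {u} {v} u≈v → none (u , v , u≈v))
    (fully-subdivided-impossible T F D dominating F⊆T
      (λ u≈v → contradiction (_ , _ , u≈v) none) 2∣D∣≤n (proj₁ tree) 3≤n)

  -- Some edge is intact; together with it, `F` is still a set of edges of a tree.
  length-preserving : suc (length F) < n
  length-preserving with x , y , x≈y ← intact-edge = length-bound _ (∷-⊆E T F F⊆T x≈y)

  preserving⇒spider : n ≤ suc (suc (length F)) → ∃[ r ] T ≅ corona (star r)
  preserving⇒spider n≤2+∣F∣ with x , y , x≈y ← intact-edge =
    matched-tree-is-spider T tree
      (ι T F D dominating F⊆T matching 2∣D∣≤n)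
      (ι-two T F D dominating F⊆T matching 2∣D∣≤n) 2∣D∣≤n
      (same-dominator-adjacent T F D dominating F⊆T matching 2∣D∣≤n
        ∘ ι⇒dominator T F D dominating F⊆T matching 2∣D∣≤n)
      (proj₁ c) (proj₂ c)
    where
    only-xy : ∀ {u v} → inj₁ u ≈ inj₁ v → (u ≡ x × v ≡ y) ⊎ (u ≡ y × v ≡ x)
    only-xy {u} {v} u≈v with ≡-dec _≟_ _≟_ (sort u v) (sort x y)
    ... | yes eq = sort-injective eq
    -- A second intact edge would give a set of `length F + 2` edges, which is at least `n`.
    ... | no neq = contradiction (ℕ.≤-trans (length-bound _ (∷∷-⊆E T F F⊆T u≈v x≈y neq)) n≤2+∣F∣) ℕ.1+n≰n

    matching : ∀ {u v w} → inj₁ u ≈ inj₁ v → inj₁ u ≈ inj₁ w → v ≡ w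
    matching {u} u≈v u≈w with only-xy u≈v | only-xy u≈w
    ... | inj₁ (refl , refl) | inj₁ (_ , refl)    = refl
    ... | inj₂ (refl , refl) | inj₂ (_ , refl)    = refl
    ... | inj₁ (refl , refl) | inj₂ (refl , refl) = contradiction (proj₁ u≈v) ~-irrefl
    ... | inj₂ (refl , refl) | inj₁ (refl , refl) = contradiction (proj₁ u≈v) ~-irrefl

    c = centre T F D dominating F⊆T matching 2∣D∣≤n x≈y only-xy

theorem3p9 : ∀ (n : ℕ) (T : Graph n) (q : ℕ) → 1 ≤ q → 3 ≤ n → IsTree T → Critical q T →
    (q ≡ n ∸ 1) ⇔ (∃[ r ] (1 ≤ r × T ≅ corona (star r)))
theorem3p9 n T q 1≤q 3≤n tree (_ , _ , critical , F , F⊆T , ∣F∣≡q∸1 , γ-preserved) = mk⇔ ⇒ ⇐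
  where
  1+∣F∣≡q : suc (length F) ≡ q
  -- `1 ≤ q` makes the truncated subtraction in `q ∸ 1` exact.
  1+∣F∣≡q = trans (cong suc ∣F∣≡q∸1) (ℕ.m+[n∸m]≡n 1≤q)

  n≤2+∣F∣ : q ≡ n ∸ 1 → n ≤ suc (suc (length F))
  n≤2+∣F∣ q≡n∸1 = subst (λ m → n ≤ suc m) (sym (trans 1+∣F∣≡q q≡n∸1)) (ℕ.m≤n+m∸n n 1)

  ⇒ : q ≡ n ∸ 1 → ∃[ r ] (1 ≤ r × T ≅ corona (star r))
  ⇒ q≡n∸1 with preserving⇒spider T tree 3≤n F F⊆T γ-preserved (n≤2+∣F∣ q≡n∸1)
  ... | suc r , iso = suc r , s≤s z≤n , iso
  -- For `r = 0` the spider has only two vertices.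
  ... | zero  , iso = contradiction (subst (3 ≤_) (spider-order T iso) 3≤n) λ { (s≤s (s≤s ())) }

  ⇐ : ∃[ r ] (1 ≤ r × T ≅ corona (star r)) → q ≡ n ∸ 1
  ⇐ (r , _ , iso) = ℕ.≤-antisym
    (ℕ.<⇒≤pred (subst (_< n) 1+∣F∣≡q (length-preserving T tree 3≤n F F⊆T γ-preserved)))
    -- Since `n ∸ 1` is `2r + 1`, a smaller `q` is at most `2r`. Then some `q` rays can be
    -- subdivided without raising the domination number, against criticality.
    (ℕ.≮⇒≥ λ q<n∸1 → too-few (ℕ.≤-pred (subst (q <_) n∸1≡ q<n∸1)))
    where
    n∸1≡ : n ∸ 1 ≡ suc (r + r)
    n∸1≡ = trans (cong (_∸ 1) (spider-order T iso)) (ℕ.+-suc r r)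

    too-few : ¬ (q ≤ r + r)
    too-few q≤2r with γ-preserving-edges T iso q≤2r
    ... | E , E⊆T , ∣E∣≡q , γ≤ = ℕ.<⇒≱ (critical E E⊆T ∣E∣≡q) (ℕ.≤-trans γ≤ (γ-spider T iso))
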